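{- Every $N\in\mathbb Z$ has a unique representation $N=\sum_{j=1}^n y_jT_{n-j}$ with $y_1\ne0$ and $y_1\cdots y_n\in\{ -1,0,1\}^*$ containing no factor from the set $X=\{11,101,1\bar1\}$ together with their opposites.
   Context: Tribonacci numeration system: $T_0=1$, $T_1=2$, $T_2=4$, $T_n=T_{n-1}+T_{n-2}+T_{n-3}$ for $n\ge3$. $\bar1$ denotes the digit $-1$; the opposite of a word is obtained by negating every digit. A factor is a contiguous subword. -}

module Defs where

open import Data.Nat using (ℕ; zero; suc)
import Data.Nat as ℕ
open import Data.Integer using (ℤ; +_; -[1+_]; _+_; _*_; -_)
open import Data.List using (List; []; _∷_; _++_; length; map)
open import Data.Product using (∃; ∃₂; _×_)
open import Data.Sum using (_⊎_)
open import Data.Unit using (⊤)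
open import Relation.Nullary using (¬_)
open import Relation.Binary.PropositionalEquality using (_≡_; _≢_)

-- Tribonacci numbers: T 0 = 1, T 1 = 2, T 2 = 4, T n = T (n-1) + T (n-2) + T (n-3)
T : ℕ → ℕ
T zero = 1
T (suc zero) = 2
T (suc (suc zero)) = 4
T (suc (suc (suc n))) = T (suc (suc n)) ℕ.+ T (suc n) ℕ.+ T n

-- The digit alphabet {-1, 0, 1}; m1 stands for the digit 1̄ = -1.
data Digit : Set where
  m1 z p1 : Digit

digitVal : Digit → ℤ
digitVal m1 = -[1+ 0 ]
digitVal z  = + 0
digitVal p1 = + 1

-- opposite digit / word
negD : Digit → Digit
negD m1 = p1
negD z  = z
negD p1 = m1

opp : List Digit → List Digit
opp = map negD

-- value of the word y₁ ⋯ yₙ : Σ_{j=1}^n y_j T_{n-j}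
value : List Digit → ℤ
value [] = + 0
value (y ∷ ys) = digitVal y * + T (length ys) + value ys

-- f is a factor (contiguous subword) of w
Factor : List Digit → List Digit → Set
Factor f w = ∃₂ λ u v → w ≡ u ++ f ++ v

-- X = {11, 101, 11̄}
InX : List Digit → Set
InX f = f ≡ p1 ∷ p1 ∷ [] ⊎ f ≡ p1 ∷ z ∷ p1 ∷ [] ⊎ f ≡ p1 ∷ m1 ∷ []

-- forbidden factors: X together with the opposites of its elements
Forbidden : List Digit → Set
Forbidden f = InX f ⊎ InX (opp f)

-- first digit y₁ is nonzero (vacuous for the empty word, which represents 0)
LeadingNonzero : List Digit → Set
LeadingNonzero [] = ⊤
LeadingNonzero (y ∷ _) = y ≢ z

Admissible : List Digit → Set
Admissible w = LeadingNonzero w × (∀ f → Forbidden f → ¬ Factor f w)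

-- The words without forbidden factors are exactly those read by a five-state
-- automaton that remembers the last nonzero digit and whether a 0 has followed it.
-- With bound 0 = bound 1 = bound 2 = 0 and bound (3 + n) = T n + bound n, so that
-- T n = bound (2 + n) + bound (1 + n) + 1, the values of the words of length n read
-- from each state fill an integer interval exactly once.  The induction on n goes
-- through because the three possible leading digits send the value into three
-- disjoint bands around 0, ±T n.  Leading zeros are then added or removed to
-- compare words of different lengths.
module Submission where

open import Defs
open import Data.Integer using (ℤ)
open import Data.List using (List)
open import Data.Product using (∃!; _×_)
open import Relation.Binary.PropositionalEquality using (_≡_)

open import Data.Empty using (⊥; ⊥-elim)
open import Data.Integer as ℤ
  using (+_; -[1+_]; -_; _+_; _*_; _≤_; _<_; 0ℤ; 1ℤ; -1ℤ; ∣_∣; +≤+; -≤+; -≤-)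
import Data.Integer.Properties as ℤ
open import Data.Integer.Tactic.RingSolver using (solve-∀)
open import Algebra.Properties.AbelianGroup ℤ.+-0-abelianGroup using (∙-cancelˡ)
open import Data.List using ([]; _∷_; _++_; length; replicate)
open import Data.List.Properties using (length-++; length-replicate)
open import Data.Nat as ℕ using (ℕ; zero; suc; z≤n; s≤s)
import Data.Nat.Properties as ℕ
import Data.Nat.Tactic.RingSolver as ℕ-Solver
open import Data.Product using (Σ; _,_; proj₁; proj₂)
open import Data.Sign as Sign using (Sign)
open import Data.Sum using (_⊎_; inj₁; inj₂)
open import Data.Unit using (tt)
open import Relation.Nullary using (¬_; yes; no)
open import Relation.Binary.PropositionalEquality
  using (refl; sym; trans; cong; cong₂; subst; subst₂; module ≡-Reasoning)

bound : ℕ → ℕ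
bound zero = 0
bound (suc zero) = 0
bound (suc (suc zero)) = 0
bound (suc (suc (suc n))) = T n ℕ.+ bound n

T-split : ∀ n → T n ≡ bound (2 ℕ.+ n) ℕ.+ bound (1 ℕ.+ n) ℕ.+ 1
T-split zero = refl
T-split (suc zero) = refl
T-split (suc (suc zero)) = refl
T-split (suc (suc (suc n))) = begin
  T (2 ℕ.+ n) ℕ.+ T (1 ℕ.+ n) ℕ.+ T n
    ≡⟨ cong (T (2 ℕ.+ n) ℕ.+ T (1 ℕ.+ n) ℕ.+_) (T-split n) ⟩
  T (2 ℕ.+ n) ℕ.+ T (1 ℕ.+ n) ℕ.+ (bound (2 ℕ.+ n) ℕ.+ bound (1 ℕ.+ n) ℕ.+ 1)
    ≡⟨ regroup (T (2 ℕ.+ n)) (T (1 ℕ.+ n)) (bound (2 ℕ.+ n)) (bound (1 ℕ.+ n)) ⟩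
  bound (5 ℕ.+ n) ℕ.+ bound (4 ℕ.+ n) ℕ.+ 1 ∎
  where
  open ≡-Reasoning
  regroup : ∀ a b x y → a ℕ.+ b ℕ.+ (x ℕ.+ y ℕ.+ 1) ≡ (a ℕ.+ x) ℕ.+ (b ℕ.+ y) ℕ.+ 1
  regroup = ℕ-Solver.solve-∀

bound[n]≤bound[1+n] : ∀ n → bound n ℕ.≤ bound (1 ℕ.+ n)
bound[n]≤bound[1+n] zero = z≤n
bound[n]≤bound[1+n] (suc zero) = z≤n
bound[n]≤bound[1+n] (suc (suc zero)) = z≤n
bound[n]≤bound[1+n] (suc (suc (suc n))) = begin
  bound (3 ℕ.+ n)                             ≤⟨ ℕ.m≤m+n _ _ ⟩
  bound (3 ℕ.+ n) ℕ.+ bound (2 ℕ.+ n)         ≤⟨ ℕ.m≤m+n _ 1 ⟩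
  bound (3 ℕ.+ n) ℕ.+ bound (2 ℕ.+ n) ℕ.+ 1   ≡⟨ T-split (1 ℕ.+ n) ⟨
  T (1 ℕ.+ n)                                 ≤⟨ ℕ.m≤m+n _ _ ⟩
  bound (4 ℕ.+ n)                             ∎
  where open ℕ.≤-Reasoning

n≤bound[2+n] : ∀ n → n ℕ.≤ bound (2 ℕ.+ n)
n≤bound[2+n] zero = z≤n
n≤bound[2+n] (suc n) = begin
  suc n                                       ≡⟨ ℕ.+-comm 1 n ⟩
  n ℕ.+ 1                                     ≤⟨ ℕ.+-monoˡ-≤ 1 (n≤bound[2+n] n) ⟩
  bound (2 ℕ.+ n) ℕ.+ 1                       ≤⟨ ℕ.+-monoˡ-≤ 1 (ℕ.m≤m+n _ _) ⟩
  bound (2 ℕ.+ n) ℕ.+ bound (1 ℕ.+ n) ℕ.+ 1   ≡⟨ T-split n ⟨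
  T n                                         ≤⟨ ℕ.m≤m+n _ _ ⟩
  bound (3 ℕ.+ n)                             ∎
  where open ℕ.≤-Reasoning

B : ℕ → ℤ
B n = + bound n

T-splitℤ : ∀ n → + T n ≡ B (2 ℕ.+ n) + B (1 ℕ.+ n) + 1ℤ
T-splitℤ n = cong +_ (T-split n)

-B≤1+B : ∀ m k → - B m ≤ 1ℤ + B k
-B≤1+B m k = ℤ.neg-≤-pos

-1-B≤B : ∀ m k → -1ℤ + - B m ≤ B k
-1-B≤B m k = ℤ.i≤j⇒pred[i]≤j (ℤ.neg-≤-pos {bound m})

infix 4 _∈[_,_]

_∈[_,_] : ℤ → ℤ → ℤ → Set
x ∈[ a , b ] = a ≤ x × x ≤ b

∈-weaken : ∀ {a a′ b b′ x} → a′ ≤ a → b ≤ b′ → x ∈[ a , b ] → x ∈[ a′ , b′ ]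
∈-weaken a′≤a b≤b′ (a≤x , x≤b) = ℤ.≤-trans a′≤a a≤x , ℤ.≤-trans x≤b b≤b′

∈-shift : ∀ k {a b a′ b′ x} → k + a ≡ a′ → k + b ≡ b′ → x ∈[ a , b ] → k + x ∈[ a′ , b′ ]
∈-shift k refl refl (a≤x , x≤b) = ℤ.+-monoʳ-≤ k a≤x , ℤ.+-monoʳ-≤ k x≤b

∈-abs : ∀ {N k} → ∣ N ∣ ℕ.≤ k → N ∈[ - + k , + k ]
∈-abs {+ m} ∣N∣≤k = ℤ.neg-≤-pos , +≤+ ∣N∣≤k
∈-abs { -[1+ m ]} {suc k} (s≤s m≤k) = -≤- m≤k , -≤+

trichotomy : ∀ c N → N < - c ⊎ N ∈[ - c , c ] ⊎ c < N
trichotomy c N with N ℤ.<? - c | c ℤ.<? N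
... | yes N<-c | _       = inj₁ N<-c
... | no _     | yes c<N = inj₂ (inj₂ c<N)
... | no N≮-c  | no c≮N  = inj₂ (inj₁ (ℤ.≮⇒≥ N≮-c , ℤ.≮⇒≥ c≮N))

+t-∈ : ∀ {a b c t x} → t ≡ c + b + 1ℤ → x ∈[ - b , a ] → t + x ∈[ 1ℤ + c , t + a ]
+t-∈ {a} {b} {c} refl = ∈-shift (c + b + 1ℤ) (lower b c) refl
  where
  lower : ∀ b c → c + b + 1ℤ + - b ≡ 1ℤ + c
  lower = solve-∀

+t-∈⁻ : ∀ {a b c t N} → t ≡ c + b + 1ℤ → N ∈[ 1ℤ + c , t + a ] → - t + N ∈[ - b , a ]
+t-∈⁻ {a} {b} {c} refl = ∈-shift (- (c + b + 1ℤ)) (lower b c) (upper a b c)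
  where
  lower : ∀ b c → - (c + b + 1ℤ) + (1ℤ + c) ≡ - b
  lower = solve-∀
  upper : ∀ a b c → - (c + b + 1ℤ) + (c + b + 1ℤ + a) ≡ a
  upper = solve-∀

-t-∈ : ∀ {a b c t x} → t ≡ c + b + 1ℤ → x ∈[ - a , b ] → - t + x ∈[ - (t + a) , -1ℤ + - c ]
-t-∈ {a} {b} {c} refl = ∈-shift (- (c + b + 1ℤ)) (lower a b c) (upper b c)
  where
  lower : ∀ a b c → - (c + b + 1ℤ) + - a ≡ - (c + b + 1ℤ + a)
  lower = solve-∀
  upper : ∀ b c → - (c + b + 1ℤ) + b ≡ -1ℤ + - c
  upper = solve-∀

-t-∈⁻ : ∀ {a b c t N} → t ≡ c + b + 1ℤ → N ∈[ - (t + a) , -1ℤ + - c ] → t + N ∈[ - a , b ]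
-t-∈⁻ {a} {b} {c} refl = ∈-shift (c + b + 1ℤ) (lower a b c) (upper b c)
  where
  lower : ∀ a b c → c + b + 1ℤ + - (c + b + 1ℤ + a) ≡ - a
  lower = solve-∀
  upper : ∀ b c → c + b + 1ℤ + (-1ℤ + - c) ≡ b
  upper = solve-∀

-- Band d n is where the value of d ∷ w lies when w has length n.

Band : Digit → ℕ → ℤ → Set
Band z  n N = N ∈[ - B (2 ℕ.+ n) , B (2 ℕ.+ n) ]
Band p1 n N = N ∈[ 1ℤ + B (2 ℕ.+ n) , B (3 ℕ.+ n) ]
Band m1 n N = N ∈[ - B (3 ℕ.+ n) , -1ℤ + - B (2 ℕ.+ n) ]

band-cover : ∀ n {N} → N ∈[ - B (3 ℕ.+ n) , B (3 ℕ.+ n) ] → Σ Digit λ d → Band d n N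
band-cover n {N} (lo , hi) with trichotomy (B (2 ℕ.+ n)) N
... | inj₁ N<-c        = m1 , lo , ℤ.i<j⇒i≤pred[j] N<-c
... | inj₂ (inj₁ N∈)   = z , N∈
... | inj₂ (inj₂ c<N)  = p1 , ℤ.i<j⇒suc[i]≤j c<N , hi

below-and-above : ∀ {c N} → N ≤ c → 1ℤ + c ≤ N → ⊥
below-and-above N≤c 1+c≤N = ℤ.<⇒≱ (ℤ.suc[i]≤j⇒i<j 1+c≤N) N≤c

above-and-below : ∀ {c N} → - c ≤ N → N ≤ -1ℤ + - c → ⊥
above-and-below -c≤N N≤-1-c = ℤ.<⇒≱ (ℤ.i≤pred[j]⇒i<j N≤-1-c) -c≤N

band-unique : ∀ {d d′ n N} → Band d n N → Band d′ n N → d ≡ d′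
band-unique {z}  {z}  _ _ = refl
band-unique {p1} {p1} _ _ = refl
band-unique {m1} {m1} _ _ = refl
band-unique {z}  {p1} (_ , N≤c) (1+c≤N , _) = ⊥-elim (below-and-above N≤c 1+c≤N)
band-unique {p1} {z}  (1+c≤N , _) (_ , N≤c) = ⊥-elim (below-and-above N≤c 1+c≤N)
band-unique {z}  {m1} (-c≤N , _) (_ , N≤-1-c) = ⊥-elim (above-and-below -c≤N N≤-1-c)
band-unique {m1} {z}  (_ , N≤-1-c) (-c≤N , _) = ⊥-elim (above-and-below -c≤N N≤-1-c)
band-unique {p1} {m1} {n} (1+c≤N , _) (_ , N≤-1-c) =
  ⊥-elim (above-and-below (ℤ.≤-trans (-B≤1+B (2 ℕ.+ n) (2 ℕ.+ n)) 1+c≤N) N≤-1-c)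
band-unique {m1} {p1} {n} (_ , N≤-1-c) (1+c≤N , _) =
  ⊥-elim (above-and-below (ℤ.≤-trans (-B≤1+B (2 ℕ.+ n) (2 ℕ.+ n)) 1+c≤N) N≤-1-c)

digit : Sign → Digit
digit Sign.+ = p1
digit Sign.- = m1

-- after x: the last digit read is x ≠ 0; after0 x: the last two digits are x 0.
data State : Set where
  free : State
  after after0 : Sign → State

data Step : State → Digit → State → Set where
  free-0   : Step free z free
  free-+   : Step free p1 (after Sign.+)
  free--   : Step free m1 (after Sign.-)
  after-0  : ∀ {x} → Step (after x) z (after0 x)
  after0-0 : ∀ {x} → Step (after0 x) z free
  after0+- : Step (after0 Sign.+) m1 (after Sign.-)
  after0-+ : Step (after0 Sign.-) p1 (after Sign.+)

infixr 5 _∷_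

data Run : State → List Digit → Set where
  []  : ∀ {s} → Run s []
  _∷_ : ∀ {s d s′ w} → Step s d s′ → Run s′ w → Run s (d ∷ w)

step-deterministic : ∀ {s d s₁ s₂} → Step s d s₁ → Step s d s₂ → s₁ ≡ s₂
step-deterministic free-0   free-0   = refl
step-deterministic free-+   free-+   = refl
step-deterministic free--   free--   = refl
step-deterministic after-0  after-0  = refl
step-deterministic after0-0 after0-0 = refl
step-deterministic after0+- after0+- = refl
step-deterministic after0-+ after0-+ = refl

ForbiddenFree : List Digit → Set
ForbiddenFree w = ∀ f → Forbidden f → ¬ Factor f w

forbiddenFree-tail : ∀ {d w} → ForbiddenFree (d ∷ w) → ForbiddenFree w
forbiddenFree-tail h f f-forbidden (u , v , refl) = h f f-forbidden (_ ∷ u , v , refl)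

forbidden-prefix : ∀ {f v} → Forbidden f → ¬ ForbiddenFree (f ++ v)
forbidden-prefix {f} {v} f-forbidden h = h f f-forbidden ([] , v , refl)

forbiddenFree⇒run-free   : ∀ w → ForbiddenFree w → Run free w
forbiddenFree⇒run-after  : ∀ x w → ForbiddenFree (digit x ∷ w) → Run (after x) w
forbiddenFree⇒run-after0 : ∀ x w → ForbiddenFree (digit x ∷ z ∷ w) → Run (after0 x) w

forbiddenFree⇒run-free [] _ = []
forbiddenFree⇒run-free (z ∷ w) h = free-0 ∷ forbiddenFree⇒run-free w (forbiddenFree-tail h)
forbiddenFree⇒run-free (p1 ∷ w) h = free-+ ∷ forbiddenFree⇒run-after Sign.+ w h
forbiddenFree⇒run-free (m1 ∷ w) h = free-- ∷ forbiddenFree⇒run-after Sign.- w h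

forbiddenFree⇒run-after x [] _ = []
forbiddenFree⇒run-after x (z ∷ w) h = after-0 ∷ forbiddenFree⇒run-after0 x w h
forbiddenFree⇒run-after Sign.+ (p1 ∷ w) h = ⊥-elim (forbidden-prefix (inj₁ (inj₁ refl)) h)
forbiddenFree⇒run-after Sign.+ (m1 ∷ w) h = ⊥-elim (forbidden-prefix (inj₁ (inj₂ (inj₂ refl))) h)
forbiddenFree⇒run-after Sign.- (p1 ∷ w) h = ⊥-elim (forbidden-prefix (inj₂ (inj₂ (inj₂ refl))) h)
forbiddenFree⇒run-after Sign.- (m1 ∷ w) h = ⊥-elim (forbidden-prefix (inj₂ (inj₁ refl)) h)

forbiddenFree⇒run-after0 x [] _ = []
forbiddenFree⇒run-after0 x (z ∷ w) h =
  after0-0 ∷ forbiddenFree⇒run-free w (forbiddenFree-tail (forbiddenFree-tail (forbiddenFree-tail h)))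
forbiddenFree⇒run-after0 Sign.+ (m1 ∷ w) h =
  after0+- ∷ forbiddenFree⇒run-after Sign.- w (forbiddenFree-tail (forbiddenFree-tail h))
forbiddenFree⇒run-after0 Sign.- (p1 ∷ w) h =
  after0-+ ∷ forbiddenFree⇒run-after Sign.+ w (forbiddenFree-tail (forbiddenFree-tail h))
forbiddenFree⇒run-after0 Sign.+ (p1 ∷ w) h = ⊥-elim (forbidden-prefix (inj₁ (inj₂ (inj₁ refl))) h)
forbiddenFree⇒run-after0 Sign.- (m1 ∷ w) h = ⊥-elim (forbidden-prefix (inj₂ (inj₂ (inj₁ refl))) h)

negD-involutive : ∀ d → negD (negD d) ≡ d
negD-involutive m1 = refl
negD-involutive z  = refl
negD-involutive p1 = refl

opp-involutive : ∀ w → opp (opp w) ≡ w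
opp-involutive [] = refl
opp-involutive (d ∷ w) = cong₂ _∷_ (negD-involutive d) (opp-involutive w)

InX-stuck : ∀ {f s v} → InX f → ¬ Run s (f ++ v)
InX-stuck (inj₁ refl)        (free-+   ∷ () ∷ _)
InX-stuck (inj₁ refl)        (after0-+ ∷ () ∷ _)
InX-stuck (inj₂ (inj₁ refl)) (free-+   ∷ after-0 ∷ () ∷ _)
InX-stuck (inj₂ (inj₁ refl)) (after0-+ ∷ after-0 ∷ () ∷ _)
InX-stuck (inj₂ (inj₂ refl)) (free-+   ∷ () ∷ _)
InX-stuck (inj₂ (inj₂ refl)) (after0-+ ∷ () ∷ _)

opp-InX-stuck : ∀ {f s v} → InX f → ¬ Run s (opp f ++ v)
opp-InX-stuck (inj₁ refl)        (free--   ∷ () ∷ _)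
opp-InX-stuck (inj₁ refl)        (after0+- ∷ () ∷ _)
opp-InX-stuck (inj₂ (inj₁ refl)) (free--   ∷ after-0 ∷ () ∷ _)
opp-InX-stuck (inj₂ (inj₁ refl)) (after0+- ∷ after-0 ∷ () ∷ _)
opp-InX-stuck (inj₂ (inj₂ refl)) (free--   ∷ () ∷ _)
opp-InX-stuck (inj₂ (inj₂ refl)) (after0+- ∷ () ∷ _)

forbidden-stuck : ∀ {f s v} → Forbidden f → ¬ Run s (f ++ v)
forbidden-stuck (inj₁ f∈X) r = InX-stuck f∈X r
forbidden-stuck {f} {s} {v} (inj₂ opp-f∈X) r =
  opp-InX-stuck opp-f∈X (subst (λ g → Run s (g ++ v)) (sym (opp-involutive f)) r)

run-drop : ∀ {s} u {w} → Run s (u ++ w) → Σ State λ s′ → Run s′ w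
run-drop [] r = _ , r
run-drop (_ ∷ u) (_ ∷ r) = run-drop u r

run⇒forbiddenFree : ∀ {s w} → Run s w → ForbiddenFree w
run⇒forbiddenFree r f f-forbidden (u , v , refl) = forbidden-stuck f-forbidden (proj₂ (run-drop u r))

lower upper : State → ℕ → ℤ
lower free            n = - B (2 ℕ.+ n)
lower (after Sign.+)  n = - B (1 ℕ.+ n)
lower (after Sign.-)  n = - B n
lower (after0 Sign.+) n = - B (2 ℕ.+ n)
lower (after0 Sign.-) n = - B (1 ℕ.+ n)
upper free            n = B (2 ℕ.+ n)
upper (after Sign.+)  n = B n
upper (after Sign.-)  n = B (1 ℕ.+ n)
upper (after0 Sign.+) n = B (1 ℕ.+ n)
upper (after0 Sign.-) n = B (2 ℕ.+ n)

Range : State → ℕ → ℤ → Set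
Range s n N = N ∈[ lower s n , upper s n ]

range-zero : ∀ s → lower s 0 ≡ 0ℤ × upper s 0 ≡ 0ℤ
range-zero free            = refl , refl
range-zero (after Sign.+)  = refl , refl
range-zero (after Sign.-)  = refl , refl
range-zero (after0 Sign.+) = refl , refl
range-zero (after0 Sign.-) = refl , refl

B-mono : ∀ n → B n ≤ B (1 ℕ.+ n)
B-mono n = +≤+ (bound[n]≤bound[1+n] n)

-B-mono : ∀ n → - B (1 ℕ.+ n) ≤ - B n
-B-mono n = ℤ.neg-mono-≤ (B-mono n)

z∷-value : ∀ k N → digitVal z * k + N ≡ N
z∷-value k N = ℤ.+-identityˡ N

p1∷-value : ∀ k N → digitVal p1 * k + N ≡ k + N
p1∷-value k N = cong (_+ N) (ℤ.*-identityˡ k)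

m1∷-value : ∀ k N → digitVal m1 * k + N ≡ - k + N
m1∷-value k N = cong (_+ N) (ℤ.-1*i≡-i k)

value-z∷ : ∀ w → value (z ∷ w) ≡ value w
value-z∷ w = z∷-value (+ T (length w)) (value w)

head∈band : ∀ {s d s′} n {N} → Step s d s′ → Range s′ n N → Band d n (digitVal d * + T n + N)
head∈band n free-0 h = subst (Band z n) (sym (z∷-value (+ T n) _)) h
head∈band n after0-0 h = subst (Band z n) (sym (z∷-value (+ T n) _)) h
head∈band n (after-0 {Sign.+}) h =
  subst (Band z n) (sym (z∷-value (+ T n) _)) (∈-weaken ℤ.≤-refl (B-mono (1 ℕ.+ n)) h)
head∈band n (after-0 {Sign.-}) h =
  subst (Band z n) (sym (z∷-value (+ T n) _)) (∈-weaken (-B-mono (1 ℕ.+ n)) ℤ.≤-refl h)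
head∈band n free-+ h =
  subst (Band p1 n) (sym (p1∷-value (+ T n) _)) (+t-∈ {c = B (2 ℕ.+ n)} (T-splitℤ n) h)
head∈band n after0-+ h =
  subst (Band p1 n) (sym (p1∷-value (+ T n) _)) (+t-∈ {c = B (2 ℕ.+ n)} (T-splitℤ n) h)
head∈band n free-- h =
  subst (Band m1 n) (sym (m1∷-value (+ T n) _)) (-t-∈ {c = B (2 ℕ.+ n)} (T-splitℤ n) h)
head∈band n after0+- h =
  subst (Band m1 n) (sym (m1∷-value (+ T n) _)) (-t-∈ {c = B (2 ℕ.+ n)} (T-splitℤ n) h)

step-range : ∀ {s d s′} n {N} → Step s d s′ → Range s′ n N → Range s (suc n) (digitVal d * + T n + N)
step-range n st@free-0 h =
  ∈-weaken (-B-mono (2 ℕ.+ n)) (B-mono (2 ℕ.+ n)) (head∈band n st h)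
step-range n st@free-+ h = ∈-weaken (-B≤1+B (3 ℕ.+ n) (2 ℕ.+ n)) ℤ.≤-refl (head∈band n st h)
step-range n st@free-- h = ∈-weaken ℤ.≤-refl (-1-B≤B (2 ℕ.+ n) (3 ℕ.+ n)) (head∈band n st h)
step-range n (after-0 {Sign.+}) h = subst (Range (after Sign.+) (suc n)) (sym (z∷-value (+ T n) _)) h
step-range n (after-0 {Sign.-}) h = subst (Range (after Sign.-) (suc n)) (sym (z∷-value (+ T n) _)) h
step-range n st@(after0-0 {Sign.+}) h = ∈-weaken (-B-mono (2 ℕ.+ n)) ℤ.≤-refl (head∈band n st h)
step-range n st@(after0-0 {Sign.-}) h = ∈-weaken ℤ.≤-refl (B-mono (2 ℕ.+ n)) (head∈band n st h)
step-range n st@after0+- h = ∈-weaken ℤ.≤-refl (-1-B≤B (2 ℕ.+ n) (2 ℕ.+ n)) (head∈band n st h)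
step-range n st@after0-+ h = ∈-weaken (-B≤1+B (2 ℕ.+ n) (2 ℕ.+ n)) ℤ.≤-refl (head∈band n st h)

value∈range : ∀ {s w} → Run s w → Range s (length w) (value w)
value∈range {s} [] with range-zero s
... | lower≡0 , upper≡0 = ℤ.≤-reflexive lower≡0 , ℤ.≤-reflexive (sym upper≡0)
value∈range {w = _ ∷ w} (st ∷ r) = step-range (length w) st (value∈range r)

value-∷-cancel : ∀ {d w₁ w₂} → length w₁ ≡ length w₂ →
                 value (d ∷ w₁) ≡ value (d ∷ w₂) → value w₁ ≡ value w₂
value-∷-cancel {d} {w₁} {w₂} eqₗ eqᵥ =
  ∙-cancelˡ (digitVal d * + T (length w₂)) (value w₁) (value w₂)
    (subst (λ n → digitVal d * + T n + value w₁ ≡ value (d ∷ w₂)) eqₗ eqᵥ)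

same-head : ∀ {s d₁ d₂ s₁ s₂ w₁ w₂} → Step s d₁ s₁ → Run s₁ w₁ → Step s d₂ s₂ → Run s₂ w₂ →
            length w₁ ≡ length w₂ → value (d₁ ∷ w₁) ≡ value (d₂ ∷ w₂) → d₁ ≡ d₂
same-head {d₁ = d₁} {d₂} {w₁ = w₁} {w₂} st₁ r₁ st₂ r₂ eqₗ eqᵥ =
  band-unique {d₁} {d₂} {length w₁} {value (d₁ ∷ w₁)}
    (head∈band (length w₁) st₁ (value∈range r₁))
    (subst₂ (Band d₂) (sym eqₗ) (sym eqᵥ) (head∈band (length w₂) st₂ (value∈range r₂)))

run-unique : ∀ {s w₁ w₂} → Run s w₁ → Run s w₂ →
             length w₁ ≡ length w₂ → value w₁ ≡ value w₂ → w₁ ≡ w₂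
run-unique [] [] _ _ = refl
run-unique {w₁ = d ∷ w₁} {_ ∷ w₂} (st₁ ∷ r₁) (st₂ ∷ r₂) eqₗ eqᵥ
  with same-head st₁ r₁ st₂ r₂ (ℕ.suc-injective eqₗ) eqᵥ
... | refl with step-deterministic st₁ st₂
... | refl = cong (d ∷_) (run-unique r₁ r₂ (ℕ.suc-injective eqₗ)
                           (value-∷-cancel {d} {w₁} {w₂} (ℕ.suc-injective eqₗ) eqᵥ))

RunOf : State → ℕ → ℤ → Set
RunOf s n N = Σ (List Digit) λ w → Run s w × length w ≡ n × value w ≡ N

extend : ∀ {s d s′ n M N} → Step s d s′ → digitVal d * + T n + M ≡ N →
         RunOf s′ n M → RunOf s (suc n) N
extend st refl (w , r , refl , refl) = _ ∷ w , st ∷ r , refl , refl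

run-exists : ∀ s n {N} → Range s n N → RunOf s n N

extend-0 : ∀ {s s′ n N} → Step s z s′ → Range s′ n N → RunOf s (suc n) N
extend-0 {s′ = s′} {n} st h = extend st (z∷-value (+ T n) _) (run-exists s′ n h)

extend-+ : ∀ {s n N} → Step s p1 (after Sign.+) → Band p1 n N → RunOf s (suc n) N
extend-+ {n = n} {N} st b =
  extend st (trans (p1∷-value (+ T n) _) (t+[-t+N]≡N (+ T n) N))
    (run-exists _ n (+t-∈⁻ {c = B (2 ℕ.+ n)} (T-splitℤ n) b))
  where
  t+[-t+N]≡N : ∀ t N → t + (- t + N) ≡ N
  t+[-t+N]≡N = solve-∀

extend-- : ∀ {s n N} → Step s m1 (after Sign.-) → Band m1 n N → RunOf s (suc n) N
extend-- {n = n} {N} st b =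
  extend st (trans (m1∷-value (+ T n) _) (-t+[t+N]≡N (+ T n) N))
    (run-exists _ n (-t-∈⁻ {c = B (2 ℕ.+ n)} (T-splitℤ n) b))
  where
  -t+[t+N]≡N : ∀ t N → - t + (t + N) ≡ N
  -t+[t+N]≡N = solve-∀

run-exists s zero {N} (lower≤N , N≤upper) with range-zero s
... | lower≡0 , upper≡0 =
  [] , [] , refl , ℤ.≤-antisym (subst (_≤ N) lower≡0 lower≤N) (subst (N ≤_) upper≡0 N≤upper)
run-exists free (suc n) h with band-cover n h
... | z  , b = extend-0 free-0 b
... | p1 , b = extend-+ free-+ b
... | m1 , b = extend-- free-- b
run-exists (after Sign.+) (suc n) h = extend-0 after-0 h
run-exists (after Sign.-) (suc n) h = extend-0 after-0 h
run-exists (after0 Sign.+) (suc n) h with band-cover n (∈-weaken ℤ.≤-refl (B-mono (2 ℕ.+ n)) h)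
... | z  , b = extend-0 after0-0 b
... | m1 , b = extend-- after0+- b
... | p1 , (1+c≤N , _) = ⊥-elim (below-and-above (proj₂ h) 1+c≤N)
run-exists (after0 Sign.-) (suc n) h with band-cover n (∈-weaken (-B-mono (2 ℕ.+ n)) ℤ.≤-refl h)
... | z  , b = extend-0 after0-0 b
... | p1 , b = extend-+ after0-+ b
... | m1 , (_ , N≤-1-c) = ⊥-elim (above-and-below (proj₁ h) N≤-1-c)

run-pad : ∀ k {w} → Run free w → Run free (replicate k z ++ w)
run-pad zero r = r
run-pad (suc k) r = free-0 ∷ run-pad k r

value-pad : ∀ k w → value (replicate k z ++ w) ≡ value w
value-pad zero w = refl
value-pad (suc k) w = trans (value-z∷ (replicate k z ++ w)) (value-pad k w)

length-pad : ∀ k w → length (replicate k z ++ w) ≡ k ℕ.+ length w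
length-pad k w = trans (length-++ (replicate k z)) (cong (ℕ._+ length w) (length-replicate k))

dropZeros : List Digit → List Digit
dropZeros [] = []
dropZeros (z ∷ w) = dropZeros w
dropZeros (p1 ∷ w) = p1 ∷ w
dropZeros (m1 ∷ w) = m1 ∷ w

dropZeros-pad : ∀ k w → dropZeros (replicate k z ++ w) ≡ dropZeros w
dropZeros-pad zero w = refl
dropZeros-pad (suc k) w = dropZeros-pad k w

dropZeros-leadingNonzero : ∀ {w} → LeadingNonzero w → dropZeros w ≡ w
dropZeros-leadingNonzero {[]} _ = refl
dropZeros-leadingNonzero {z ∷ w} y≢z = ⊥-elim (y≢z refl)
dropZeros-leadingNonzero {p1 ∷ w} _ = refl
dropZeros-leadingNonzero {m1 ∷ w} _ = refl

leadingNonzero-dropZeros : ∀ w → LeadingNonzero (dropZeros w)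
leadingNonzero-dropZeros [] = tt
leadingNonzero-dropZeros (z ∷ w) = leadingNonzero-dropZeros w
leadingNonzero-dropZeros (p1 ∷ w) = λ ()
leadingNonzero-dropZeros (m1 ∷ w) = λ ()

value-dropZeros : ∀ w → value (dropZeros w) ≡ value w
value-dropZeros [] = refl
value-dropZeros (z ∷ w) = trans (value-dropZeros w) (sym (value-z∷ w))
value-dropZeros (p1 ∷ w) = refl
value-dropZeros (m1 ∷ w) = refl

run-dropZeros : ∀ {w} → Run free w → Run free (dropZeros w)
run-dropZeros [] = []
run-dropZeros (free-0 ∷ r) = run-dropZeros r
run-dropZeros r@(free-+ ∷ _) = r
run-dropZeros r@(free-- ∷ _) = r

leadingNonzero-unique : ∀ {w₁ w₂} → Run free w₁ → Run free w₂ →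
                        LeadingNonzero w₁ → LeadingNonzero w₂ → value w₁ ≡ value w₂ → w₁ ≡ w₂
leadingNonzero-unique {w₁} {w₂} r₁ r₂ l₁ l₂ eqᵥ = begin
  w₁                               ≡⟨ dropZeros-leadingNonzero l₁ ⟨
  dropZeros w₁                     ≡⟨ dropZeros-pad n₂ w₁ ⟨
  dropZeros (replicate n₂ z ++ w₁) ≡⟨ cong dropZeros padded-equal ⟩
  dropZeros (replicate n₁ z ++ w₂) ≡⟨ dropZeros-pad n₁ w₂ ⟩
  dropZeros w₂                     ≡⟨ dropZeros-leadingNonzero l₂ ⟩
  w₂                               ∎
  where
  open ≡-Reasoning
  n₁ n₂ : ℕ
  n₁ = length w₁
  n₂ = length w₂
  padded-equal : replicate n₂ z ++ w₁ ≡ replicate n₁ z ++ w₂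
  padded-equal = run-unique (run-pad n₂ r₁) (run-pad n₁ r₂)
    (trans (length-pad n₂ w₁) (trans (ℕ.+-comm n₂ n₁) (sym (length-pad n₁ w₂))))
    (trans (value-pad n₂ w₁) (trans eqᵥ (sym (value-pad n₁ w₂))))

representation : ∀ N → Σ (List Digit) λ w → Run free w × LeadingNonzero w × value w ≡ N
representation N with run-exists free ∣ N ∣ {N} (∈-abs (n≤bound[2+n] ∣ N ∣))
... | w , r , _ , value≡N =
  dropZeros w , run-dropZeros r , leadingNonzero-dropZeros w , trans (value-dropZeros w) value≡N

mainTheorem13 : (N : ℤ) → ∃! _≡_ (λ (w : List Digit) → Admissible w × value w ≡ N)
mainTheorem13 N with representation N
... | w , r , l , refl = w , ((l , run⇒forbiddenFree r) , refl) , unique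
  where
  unique : ∀ {y} → Admissible y × value y ≡ value w → w ≡ y
  unique ((l′ , y-forbiddenFree) , eqᵥ) =
    leadingNonzero-unique r (forbiddenFree⇒run-free _ y-forbiddenFree) l l′ (sym eqᵥ)
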